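{- Let $m$ be a positive integer and let $A=[a_{ij}]_{1\le i,j\le 2m}$ be a skew-symmetric matrix of even order over a commutative ring such that $a_{ij}=0$ whenever $i+j\in\{2q:\ q=2,3,\ldots\}$. Then $$\mathrm{per}(A)=(-1)^m\left(\mathrm{per}[a_{2i,2j-1}]_{1\le i,j\le m}\right)^2$$ and $$\det(A)=\left(\det[a_{2i,2j-1}]_{1\le i,j\le m}\right)^2.$$
   Context: A matrix $A=[a_{ij}]_{1\le i,j\le n}$ over a commutative ring is called skew-symmetric if $a_{ji}=-a_{ij}$ for all $i,j=1,\ldots,n$ (no further condition is imposed on the diagonal). For an $n\times n$ matrix $A=[a_{i,j}]_{1\le i,j\le n}$ over a commutative ring, $\det(A)=\sum_{\sigma\in S_n}\mathrm{sign}(\sigma)\prod_{i=1}^n a_{i,\sigma(i)}$ is the determinant and $\mathrm{per}(A)=\sum_{\sigma\in S_n}\prod_{i=1}^n a_{i,\sigma(i)}$ is the permanent, where $S_n$ is the symmetric group on $\{1,\ldots,n\}$. -}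

module Defs where

open import Algebra.Bundles using (CommutativeRing; Semiring)
import Algebra.Definitions.RawSemiring as RawSemiringDefinitions
open import Data.Fin.Base using (Fin; zero; suc; toℕ; combine; punchIn; _<_)
open import Data.Fin.Patterns using (0F; 1F)
open import Data.Fin.Permutation
  using (Permutation′; _⟨$⟩ʳ_; id; insert; remove; insert-punchIn; insert-remove)
  renaming (_≈_ to _≈ₚ_)
open import Data.Fin.Properties using (_<?_; toℕ-combine; punchIn-injective)
open import Data.List.Base
  using (List; []; _∷_; map; concat; tabulate; foldr; filter; length; allFin; cartesianProduct)
open import Data.List.Relation.Unary.All as All using (All)
open import Data.List.Relation.Unary.All.Properties as All using ()
open import Data.List.Relation.Unary.AllPairs as AllPairs using (AllPairs)
open import Data.List.Relation.Unary.AllPairs.Properties as AllPairs using ()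
open import Data.List.Relation.Unary.Any as Any using (Any; here)
open import Data.List.Relation.Unary.Any.Properties as Any using ()
open import Data.Nat.Base using (ℕ; zero; suc) renaming (_+_ to _+ℕ_; _*_ to _*ℕ_)
open import Data.Nat.Properties using (+-comm; *-suc; +-identityʳ)
open import Data.Product.Base using (_×_; _,_)
open import Level using (Level)
open import Relation.Binary.PropositionalEquality
  using (_≡_; refl; sym; trans; cong)
open import Relation.Nullary using (¬_; Dec)
open import Relation.Nullary.Decidable using (_×-dec_)

-- S_n, listed by the image of the first point; `permutations-complete` and
-- `permutations-unique` show that each permutation occurs exactly once.
permutations : ∀ n → List (Permutation′ n)
permutations zero    = id ∷ []
permutations (suc n) = concat (tabulate λ j → map (insert zero j) (permutations n))

private
  insert-cong : ∀ {n} j {π ρ : Permutation′ n} → π ≈ₚ ρ →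
                insert zero j π ≈ₚ insert zero j ρ
  insert-cong j π≈ρ zero = refl
  insert-cong j {π} {ρ} π≈ρ (suc k) =
    trans (insert-punchIn zero j π k)
      (trans (cong (punchIn j) (π≈ρ k))
        (sym (insert-punchIn zero j ρ k)))

  insert-injective : ∀ {n} j {π ρ : Permutation′ n} →
                     insert zero j π ≈ₚ insert zero j ρ → π ≈ₚ ρ
  insert-injective j {π} {ρ} eq k = punchIn-injective j _ _
    (trans (sym (insert-punchIn zero j π k))
      (trans (eq (suc k)) (insert-punchIn zero j ρ k)))

permutations-complete : ∀ {n} (π : Permutation′ n) → Any (π ≈ₚ_) (permutations n)
permutations-complete {zero}  π = here λ ()
permutations-complete {suc n} π = Any.concat⁺
  (Any.tabulate⁺ {f = λ j → map (insert zero j) (permutations n)} (π ⟨$⟩ʳ zero)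
    (Any.map⁺ {f = insert zero (π ⟨$⟩ʳ zero)} (Any.map
      (λ {ρ} eq i → trans (sym (insert-remove zero π i))
                          (insert-cong (π ⟨$⟩ʳ zero) {remove zero π} {ρ} eq i))
      (permutations-complete (remove zero π)))))

permutations-unique : ∀ n → AllPairs (λ π ρ → ¬ π ≈ₚ ρ) (permutations n)
permutations-unique zero    = All.[] AllPairs.∷ AllPairs.[]
permutations-unique (suc n) = AllPairs.concat⁺
  (All.tabulate⁺ {f = block} λ j → AllPairs.map⁺ {f = insert zero j} (AllPairs.map
    (λ {π} {ρ} π≉ρ eq → π≉ρ (insert-injective j {π} {ρ} eq))
    (permutations-unique n)))
  (AllPairs.tabulate⁺ {f = block} λ {i} {j} i≢j →
    All.map⁺ {f = insert zero i} (All.universal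
      (λ π → All.map⁺ {f = insert zero j}
        (All.universal (λ ρ eq → i≢j (eq zero)) (permutations n)))
      (permutations n)))
  where
  block : Fin (suc n) → List (Permutation′ (suc n))
  block j = map (insert zero j) (permutations n)

Inversion : ∀ {n} → Permutation′ n → Fin n × Fin n → Set
Inversion σ (i , j) = i < j × (σ ⟨$⟩ʳ j) < (σ ⟨$⟩ʳ i)

inversion? : ∀ {n} (σ : Permutation′ n) p → Dec (Inversion σ p)
inversion? σ (i , j) = (i <? j) ×-dec ((σ ⟨$⟩ʳ j) <? (σ ⟨$⟩ʳ i))

inversions : ∀ {n} → Permutation′ n → ℕ
inversions {n} σ = length (filter (inversion? σ) (cartesianProduct (allFin n) (allFin n)))

-- `Fin` counts from 0, so that `i : Fin n` stands for the 1-based index `index i`.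
index : ∀ {n} → Fin n → ℕ
index i = suc (toℕ i)

-- The indices 2i and 2i − 1 (1-based, in the range 1..2m) for i in 1..m; see
-- `index-2×` and `index-2×-1`.
2× 2×-1 : ∀ {m} → Fin m → Fin (m *ℕ 2)
2×   i = combine i 1F
2×-1 i = combine i 0F

index-2× : ∀ {m} (i : Fin m) → index (2× i) ≡ 2 *ℕ index i
index-2× i = trans (cong suc (toℕ-combine i 1F))
  (trans (cong suc (+-comm (2 *ℕ toℕ i) 1)) (sym (*-suc 2 (toℕ i))))

index-2×-1 : ∀ {m} (i : Fin m) → suc (index (2×-1 i)) ≡ 2 *ℕ index i
index-2×-1 i = trans (cong (2 +ℕ_) (trans (toℕ-combine i 0F) (+-identityʳ _)))
  (sym (*-suc 2 (toℕ i)))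

module Matrices {c ℓ : Level} (R : CommutativeRing c ℓ) where

  open CommutativeRing R hiding (zero; sym; trans; refl)
  open RawSemiringDefinitions (Semiring.rawSemiring semiring) using (product)
  open RawSemiringDefinitions (Semiring.rawSemiring semiring) public using (_^_)

  Matrix : ℕ → ℕ → Set c
  Matrix m n = Fin m → Fin n → Carrier

  SkewSymmetric : ∀ {n} → Matrix n n → Set ℓ
  SkewSymmetric A = ∀ i j → A j i ≈ - A i j

  sign : ∀ {n} → Permutation′ n → Carrier
  sign σ = (- 1#) ^ inversions σ

  ∑ₚ : ∀ {n} → (Permutation′ n → Carrier) → Carrier
  ∑ₚ {n} f = foldr _+_ 0# (map f (permutations n))

  det : ∀ {n} → Matrix n n → Carrier
  det A = ∑ₚ λ σ → sign σ * product (λ i → A i (σ ⟨$⟩ʳ i))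

  per : ∀ {n} → Matrix n n → Carrier
  per A = ∑ₚ λ σ → product (λ i → A i (σ ⟨$⟩ʳ i))

{-# OPTIONS --safe #-}
module Submission where

-- Only the even rows matter for the zero pattern: they are supported on the odd
-- columns, so with equally many of each the even/odd blocks make A block
-- triangular, and the possibly nonzero entry a₁₁ never contributes.  Write
-- qper_s for the sum of s^inv(σ) ∏ a_{i,σ(i)} and C for [a_{2i,2j−1}].
-- For s² = 1, Laplace expansion along the first row gives
-- qper_s(A) = s^(m²) qper_s(C) qper_s(−Cᵀ) = s^m (−1)^m qper_s(C)²,
-- where m² counts the interleaving inversions of the rows (odd before even)
-- and of the columns (even before odd).  Take s = 1 and s = −1.

open import Defs
open import Algebra.Bundles using (CommutativeRing)
import Algebra.Properties.CommutativeMonoid.Sum as CommutativeMonoidSum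
import Algebra.Properties.CommutativeSemiring.Exp as Exponentiation
import Algebra.Properties.Ring as RingProperties
import Algebra.Properties.Semiring.Sum as SemiringSum
import Algebra.Solver.CommutativeMonoid as CommutativeMonoidSolver
open import Data.Bool.Base using (true; false; if_then_else_)
open import Data.Fin.Base using (Fin; zero; suc; toℕ; punchIn; _<_)
open import Data.Fin.Permutation using (Permutation′; _⟨$⟩ʳ_; insert; insert-punchIn)
open import Data.Fin.Properties using (_<?_; punchIn-mono-≤; punchIn-cancel-≤)
open import Data.List.Base
  using (List; []; _∷_; _++_; map; concat; tabulate; foldr; filter; length; cartesianProduct)
open import Data.List.Properties using (filter-++; length-++; map-tabulate; map-∘)
open import Data.Nat.Base using (ℕ; zero; suc; NonZero; _≤_; z≤n; s≤s; s≤s⁻¹)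
  renaming (_+_ to _+ℕ_; _*_ to _*ℕ_; _<_ to _<ℕ_)
import Data.Nat.Properties as ℕ
open import Data.Nat.Solver using (module +-*-Solver)
open import Data.Product.Base using (∃; _×_; _,_)
open import Function.Base using (_∘_)
open import Function.Bundles using (_⇔_; mk⇔; module Equivalence)
import Relation.Binary.Reasoning.Setoid as SetoidReasoning
open import Relation.Binary.PropositionalEquality as ≡
  using (_≡_; cong; cong₂; subst₂; module ≡-Reasoning)
open import Relation.Nullary using (Dec; does)
open import Relation.Nullary.Decidable using (does-⇔)
open import Relation.Unary using (Pred; Decidable)

open CommutativeMonoidSum ℕ.+-0-commutativeMonoid
  using () renaming (sum to ∑ℕ; sum-cong-≗ to ∑ℕ-cong; sum-permute to ∑ℕ-permute; sum-replicate-zero to ∑ℕ-zero)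

-- Counting the inversions of an extended permutation.

𝟙 : ∀ {p} {P : Set p} → Dec P → ℕ
𝟙 P? = if does P? then 1 else 0

𝟙-cong : ∀ {p q} {P : Set p} {Q : Set q} → P ⇔ Q →
         (P? : Dec P) (Q? : Dec Q) → 𝟙 P? ≡ 𝟙 Q?
𝟙-cong P⇔Q P? Q? = cong (if_then 1 else 0) (does-⇔ P⇔Q P? Q?)

module _ {a p} {X : Set a} {P : Pred X p} (P? : Decidable P) where

  length-filter-tabulate : ∀ {n} (f : Fin n → X) →
    length (filter P? (tabulate f)) ≡ ∑ℕ (λ i → 𝟙 (P? (f i)))
  length-filter-tabulate {zero}  f = ≡.refl
  length-filter-tabulate {suc n} f with does (P? (f zero))
  ... | true  = cong suc (length-filter-tabulate (f ∘ suc))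
  ... | false = length-filter-tabulate (f ∘ suc)

-- `f` and `g` are left general because the induction passes to the tail `tabulate (f ∘ suc)`; for
-- inversions both are the identity, as in `allFin`.
length-filter-cartesianProduct :
  ∀ {a b p} {X : Set a} {Y : Set b} {P : Pred (X × Y) p} (P? : Decidable P)
  {m n} (f : Fin m → X) (g : Fin n → Y) →
  length (filter P? (cartesianProduct (tabulate f) (tabulate g)))
    ≡ ∑ℕ (λ i → ∑ℕ (λ j → 𝟙 (P? (f i , g j))))
length-filter-cartesianProduct P? {zero}  f g = ≡.refl
length-filter-cartesianProduct P? {suc m} f g = begin
  length (filter P? (row ++ rest))
    ≡⟨ cong length (filter-++ P? row rest) ⟩
  length (filter P? row ++ filter P? rest)
    ≡⟨ length-++ (filter P? row) ⟩
  length (filter P? row) +ℕ length (filter P? rest)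
    ≡⟨ cong₂ _+ℕ_
         (≡.trans (cong (length ∘ filter P?) (map-tabulate g (f zero ,_)))
                  (length-filter-tabulate P? (λ j → f zero , g j)))
         (length-filter-cartesianProduct P? (f ∘ suc) g) ⟩
  ∑ℕ (λ i → ∑ℕ (λ j → 𝟙 (P? (f i , g j)))) ∎
  where
  open ≡-Reasoning
  row  = map (f zero ,_) (tabulate g)
  rest = cartesianProduct (tabulate (f ∘ suc)) (tabulate g)

inversions-sum : ∀ {n} (σ : Permutation′ n) →
  inversions σ ≡ ∑ℕ (λ i → ∑ℕ (λ j → 𝟙 (inversion? σ (i , j))))
inversions-sum σ = length-filter-cartesianProduct (inversion? σ) (λ i → i) (λ j → j)

-- `punchIn j` runs through every position except `j`, and `toℕ j` of these lie below `j`.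
∑𝟙-punchIn< : ∀ {n} (j : Fin (suc n)) → ∑ℕ (λ k → 𝟙 (punchIn j k <? j)) ≡ toℕ j
∑𝟙-punchIn< {n}     zero    = ∑ℕ-zero n
∑𝟙-punchIn< {suc n} (suc j) = cong suc (∑𝟙-punchIn< j)

punchIn-<⇔ : ∀ {n} (i : Fin (suc n)) {j k : Fin n} → punchIn i j < punchIn i k ⇔ j < k
punchIn-<⇔ i {j} {k} = mk⇔
  (λ lt → ℕ.≰⇒> λ k≤j → ℕ.<⇒≱ lt (punchIn-mono-≤ i k j k≤j))
  (λ lt → ℕ.≰⇒> λ k≤j → ℕ.<⇒≱ lt (punchIn-cancel-≤ i k j k≤j))

-- The first point is sent to `j`, so it forms an inversion with each smaller value; reindexing by
-- `π` leaves a count of the values below `j`. Pairs of later points keep their order, since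
-- `punchIn j` preserves and reflects `_<_`.
inversions-insert : ∀ {n} (j : Fin (suc n)) (π : Permutation′ n) →
  inversions (insert zero j π) ≡ toℕ j +ℕ inversions π
inversions-insert j π = begin
  inversions σ
    ≡⟨ inversions-sum σ ⟩
  -- Pairs whose second point is `zero` vanish by computation, as nothing lies below `zero`.
  ∑ℕ (λ b → 𝟙 (inversion? σ (zero , suc b)))
    +ℕ ∑ℕ (λ a → ∑ℕ (λ b → 𝟙 (inversion? σ (suc a , suc b))))
    ≡⟨ cong₂ _+ℕ_ (∑ℕ-cong first) (∑ℕ-cong λ a → ∑ℕ-cong (other a)) ⟩
  ∑ℕ (λ b → 𝟙 (punchIn j (π ⟨$⟩ʳ b) <? j))
    +ℕ ∑ℕ (λ a → ∑ℕ (λ b → 𝟙 (inversion? π (a , b))))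
    ≡⟨ cong₂ _+ℕ_ (≡.trans (≡.sym (∑ℕ-permute (λ k → 𝟙 (punchIn j k <? j)) π)) (∑𝟙-punchIn< j))
                  (≡.sym (inversions-sum π)) ⟩
  toℕ j +ℕ inversions π ∎
  where
  open ≡-Reasoning
  σ = insert zero j π
  σ-suc : ∀ k → σ ⟨$⟩ʳ suc k ≡ punchIn j (π ⟨$⟩ʳ k)
  σ-suc = insert-punchIn zero j π
  first : ∀ b → 𝟙 (inversion? σ (zero , suc b)) ≡ 𝟙 (punchIn j (π ⟨$⟩ʳ b) <? j)
  first b = cong (λ k → 𝟙 (k <? j)) (σ-suc b)
  other : ∀ a b → 𝟙 (inversion? σ (suc a , suc b)) ≡ 𝟙 (inversion? π (a , b))
  other a b = 𝟙-cong
    (mk⇔ (λ (lt , gt) → s≤s⁻¹ lt , to (subst₂ _<_ (σ-suc b) (σ-suc a) gt))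
         (λ (lt , gt) → s≤s lt , subst₂ _<_ (≡.sym (σ-suc b)) (≡.sym (σ-suc a)) (from gt)))
    (inversion? σ (suc a , suc b)) (inversion? π (a , b))
    where open Equivalence (punchIn-<⇔ j {π ⟨$⟩ʳ b} {π ⟨$⟩ʳ a})

-- Splitting positions into two classes.

-- Interleavings of p left and q right positions, listed from position 0.
data Shuffle : ℕ → ℕ → ℕ → Set where
  []    : Shuffle 0 0 0
  left  : ∀ {p q n} → Shuffle p q n → Shuffle (suc p) q (suc n)
  right : ∀ {p q n} → Shuffle p q n → Shuffle p (suc q) (suc n)

private variable
  p q n : ℕ

injˡ : Shuffle p q n → Fin p → Fin n
injˡ (left S)  zero    = zero
injˡ (left S)  (suc k) = suc (injˡ S k)
injˡ (right S) k       = suc (injˡ S k)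

injʳ : Shuffle p q n → Fin q → Fin n
injʳ (left S)  k       = suc (injʳ S k)
injʳ (right S) zero    = zero
injʳ (right S) (suc k) = suc (injʳ S k)

shuffle-elim : ∀ {ℓ} (S : Shuffle p q n) (P : Fin n → Set ℓ) →
               (∀ k → P (injˡ S k)) → (∀ k → P (injʳ S k)) → ∀ i → P i
shuffle-elim (left S)  P l r zero    = l zero
shuffle-elim (left S)  P l r (suc i) = shuffle-elim S (P ∘ suc) (l ∘ suc) r i
shuffle-elim (right S) P l r zero    = r zero
shuffle-elim (right S) P l r (suc i) = shuffle-elim S (P ∘ suc) l (r ∘ suc) i

-- Laplace expansion strikes out a column; this is the shuffle of the columns that survive. The four
-- lemmas after `removeʳ` say that `punchIn` returns each survivor to its place in its own class.
removeˡ : Shuffle (suc p) q (suc n) → Fin (suc p) → Shuffle p q n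
removeˡ (left S)                              zero    = S
-- The tail still contains the left position to be deleted, so both `p` and `n` are successors.
removeˡ {p = suc p} {n = suc n} (left S)      (suc k) = left (removeˡ S k)
removeˡ {n = suc n} (right S)                 k       = right (removeˡ S k)

removeʳ : Shuffle p (suc q) (suc n) → Fin (suc q) → Shuffle p q n
removeʳ (right S)                             zero    = S
removeʳ {q = suc q} {n = suc n} (right S)     (suc k) = right (removeʳ S k)
removeʳ {n = suc n} (left S)                  k       = left (removeʳ S k)

injˡ-removeˡ : (S : Shuffle (suc p) q (suc n)) (k : Fin (suc p)) (i : Fin p) →
               punchIn (injˡ S k) (injˡ (removeˡ S k) i) ≡ injˡ S (punchIn k i)
injˡ-removeˡ (left S)              zero    i       = ≡.refl
injˡ-removeˡ {n = suc n} (left S)  (suc k) zero    = ≡.refl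
injˡ-removeˡ {n = suc n} (left S)  (suc k) (suc i) = cong suc (injˡ-removeˡ S k i)
injˡ-removeˡ {n = suc n} (right S) k       i       = cong suc (injˡ-removeˡ S k i)

injʳ-removeˡ : (S : Shuffle (suc p) q (suc n)) (k : Fin (suc p)) (i : Fin q) →
               punchIn (injˡ S k) (injʳ (removeˡ S k) i) ≡ injʳ S i
injʳ-removeˡ (left S)                          zero    i       = ≡.refl
injʳ-removeˡ {p = suc p} {n = suc n} (left S)  (suc k) i       = cong suc (injʳ-removeˡ S k i)
injʳ-removeˡ {n = suc n} (right S)             k       zero    = ≡.refl
injʳ-removeˡ {n = suc n} (right S)             k       (suc i) = cong suc (injʳ-removeˡ S k i)

injʳ-removeʳ : (S : Shuffle p (suc q) (suc n)) (k : Fin (suc q)) (i : Fin q) →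
               punchIn (injʳ S k) (injʳ (removeʳ S k) i) ≡ injʳ S (punchIn k i)
injʳ-removeʳ (right S)             zero    i       = ≡.refl
injʳ-removeʳ {n = suc n} (right S) (suc k) zero    = ≡.refl
injʳ-removeʳ {n = suc n} (right S) (suc k) (suc i) = cong suc (injʳ-removeʳ S k i)
injʳ-removeʳ {n = suc n} (left S)  k       i       = cong suc (injʳ-removeʳ S k i)

injˡ-removeʳ : (S : Shuffle p (suc q) (suc n)) (k : Fin (suc q)) (i : Fin p) →
               punchIn (injʳ S k) (injˡ (removeʳ S k) i) ≡ injˡ S i
injˡ-removeʳ (right S)                         zero    i       = ≡.refl
injˡ-removeʳ {q = suc q} {n = suc n} (right S) (suc k) i       = cong suc (injˡ-removeʳ S k i)
injˡ-removeʳ {n = suc n} (left S)              k       zero    = ≡.refl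
injˡ-removeʳ {n = suc n} (left S)              k       (suc i) = cong suc (injˡ-removeʳ S k i)

-- Crossing numbers.

-- The number of pairs in which a right position precedes a left one.
crossings : Shuffle p q n → ℕ
crossings []                = 0
crossings (left S)          = crossings S
crossings {p = p} (right S) = p +ℕ crossings S

-- A deleted left position takes with it its crossings with the right positions before it. Their
-- number is exactly the gap between its place `toℕ (injˡ S k)` among all positions and its rank
-- `toℕ k` among the left ones.
crossings-removeˡ : (S : Shuffle (suc p) q (suc n)) (k : Fin (suc p)) →
  toℕ (injˡ S k) +ℕ crossings (removeˡ S k) ≡ toℕ k +ℕ crossings S
crossings-removeˡ (left S) zero = ≡.refl
crossings-removeˡ {p = suc p} {n = suc n} (left S) (suc k) = cong suc (crossings-removeˡ S k)
crossings-removeˡ {p = p} {n = suc n} (right S) k = begin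
  suc (i +ℕ (p +ℕ c′))   ≡⟨ solve 3 (λ i p c′ → con 1 :+ (i :+ (p :+ c′)) := (con 1 :+ p) :+ (i :+ c′)) ≡.refl i p c′ ⟩
  suc p +ℕ (i +ℕ c′)     ≡⟨ cong (suc p +ℕ_) (crossings-removeˡ S k) ⟩
  suc p +ℕ (toℕ k +ℕ c)  ≡⟨ solve 3 (λ k p c → (con 1 :+ p) :+ (k :+ c) := k :+ ((con 1 :+ p) :+ c)) ≡.refl (toℕ k) p c ⟩
  toℕ k +ℕ (suc p +ℕ c)  ∎
  where
  open ≡-Reasoning
  open +-*-Solver
  i  = toℕ (injˡ S k)
  c  = crossings S
  c′ = crossings (removeˡ S k)

-- The witness d is the number of left positions after the removed one.
crossings-removeʳ : (S : Shuffle p (suc q) (suc n)) (k : Fin (suc q)) →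
  ∃ λ d → toℕ k +ℕ (p +ℕ crossings S) ≡ (d +ℕ d) +ℕ (toℕ (injʳ S k) +ℕ crossings (removeʳ S k))
crossings-removeʳ {p = p} (right S) zero = p , ≡.sym (ℕ.+-assoc p p (crossings S))
crossings-removeʳ {p = p} {q = suc q} {n = suc n} (right S) (suc k)
  with d , eq ← crossings-removeʳ S k = d , (begin
  suc (toℕ k +ℕ (p +ℕ (p +ℕ c)))
    ≡⟨ solve 3 (λ k p c → con 1 :+ (k :+ (p :+ (p :+ c))) := (con 1 :+ p) :+ (k :+ (p :+ c))) ≡.refl (toℕ k) p c ⟩
  suc p +ℕ (toℕ k +ℕ (p +ℕ c))
    ≡⟨ cong (suc p +ℕ_) eq ⟩
  suc p +ℕ ((d +ℕ d) +ℕ (i +ℕ c′))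
    ≡⟨ solve 4 (λ p d i c′ → (con 1 :+ p) :+ ((d :+ d) :+ (i :+ c′)) := (d :+ d) :+ (con 1 :+ (i :+ (p :+ c′)))) ≡.refl p d i c′ ⟩
  (d +ℕ d) +ℕ suc (i +ℕ (p +ℕ c′)) ∎)
  where
  open ≡-Reasoning
  open +-*-Solver
  i  = toℕ (injʳ S k)
  c  = crossings S
  c′ = crossings (removeʳ S k)
crossings-removeʳ {n = suc n} (left S) k with d , eq ← crossings-removeʳ S k =
  d , ≡.trans (ℕ.+-suc (toℕ k) _) (≡.trans (cong suc eq) (≡.sym (ℕ.+-suc (d +ℕ d) _)))

-- Positions count from 0 and indices from 1, so position `zero` has an odd index. `evens` will
-- split the rows and `odds` the columns, which places the vanishing even-even block in left rows
-- and right columns.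
evens odds : ∀ m → Shuffle m m (m *ℕ 2)
evens zero    = []
evens (suc m) = right (left (evens m))
odds zero    = []
odds (suc m) = left (right (odds m))

injˡ-evens : ∀ {m} (i : Fin m) → injˡ (evens m) i ≡ 2× i
injˡ-evens zero    = ≡.refl
injˡ-evens (suc i) = cong (λ k → suc (suc k)) (injˡ-evens i)

injʳ-evens : ∀ {m} (i : Fin m) → injʳ (evens m) i ≡ 2×-1 i
injʳ-evens zero    = ≡.refl
injʳ-evens (suc i) = cong (λ k → suc (suc k)) (injʳ-evens i)

injˡ-odds : ∀ {m} (i : Fin m) → injˡ (odds m) i ≡ 2×-1 i
injˡ-odds zero    = ≡.refl
injˡ-odds (suc i) = cong (λ k → suc (suc k)) (injˡ-odds i)

injʳ-odds : ∀ {m} (i : Fin m) → injʳ (odds m) i ≡ 2× i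
injʳ-odds zero    = ≡.refl
injʳ-odds (suc i) = cong (λ k → suc (suc k)) (injʳ-odds i)

-- `evens` and `odds` exchange the two classes, so a pair of an odd and an even index crosses in
-- exactly one of them.
crossings-evens-odds : ∀ m → crossings (evens m) +ℕ crossings (odds m) ≡ m *ℕ m
crossings-evens-odds zero    = ≡.refl
crossings-evens-odds (suc m) = begin
  suc m +ℕ e +ℕ (m +ℕ o)    ≡⟨ solve 3 (λ m e o → (con 1 :+ m) :+ e :+ (m :+ o) := (e :+ o) :+ (con 1 :+ m :+ m)) ≡.refl m e o ⟩
  (e +ℕ o) +ℕ (suc m +ℕ m)  ≡⟨ cong (_+ℕ (suc m +ℕ m)) (crossings-evens-odds m) ⟩
  m *ℕ m +ℕ (suc m +ℕ m)    ≡⟨ solve 1 (λ m → m :* m :+ (con 1 :+ m :+ m) := (con 1 :+ m) :* (con 1 :+ m)) ≡.refl m ⟩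
  suc m *ℕ suc m            ∎
  where
  open ≡-Reasoning
  open +-*-Solver
  e = crossings (evens m)
  o = crossings (odds m)

module _ {c ℓ} (R : CommutativeRing c ℓ) where
  open CommutativeRing R hiding (zero)
  open Matrices R
  open SemiringSum semiring
    using (sum; sum-cong-≋; sum-replicate-zero; ∑-comm; *-distribˡ-sum; *-distribʳ-sum)
  open CommutativeMonoidSum *-commutativeMonoid
    using () renaming (sum to product; sum-cong-≋ to product-cong)
  open Exponentiation commutativeSemiring using (^-congˡ; ^-congʳ; ^-homo-*; ^-distrib-*)
  open RingProperties ring using (-1*x≈-x; -‿involutive)
  open CommutativeMonoidSolver *-commutativeMonoid using (solve; _⊕_; _⊜_)
  open SetoidReasoning setoid

  -- Finite sums in the ring.

  sum-zero : (f : Fin n → Carrier) → (∀ i → f i ≈ 0#) → sum f ≈ 0#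
  sum-zero {n = n} f f≈0 = trans (sum-cong-≋ f≈0) (sum-replicate-zero n)

  sum-shuffle : (S : Shuffle p q n) (f : Fin n → Carrier) →
                sum f ≈ sum (f ∘ injˡ S) + sum (f ∘ injʳ S)
  sum-shuffle []        f = sym (+-identityˡ 0#)
  sum-shuffle (left S)  f = trans (+-congˡ (sum-shuffle S (f ∘ suc))) (sym (+-assoc _ _ _))
  sum-shuffle (right S) f = begin
    f zero + sum (f ∘ suc)  ≈⟨ +-congˡ (sum-shuffle S (f ∘ suc)) ⟩
    f zero + (l + r)        ≈⟨ +-assoc _ _ _ ⟨
    (f zero + l) + r        ≈⟨ +-congʳ (+-comm _ _) ⟩
    (l + f zero) + r        ≈⟨ +-assoc _ _ _ ⟩
    l + (f zero + r)        ∎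
    where
    l = sum (f ∘ suc ∘ injˡ S)
    r = sum (f ∘ suc ∘ injʳ S)

  -- The shape that `∑ₚ` has by definition, over an arbitrary list so that concatenations can be
  -- split.
  sumₗ : ∀ {a} {X : Set a} → (X → Carrier) → List X → Carrier
  sumₗ f xs = foldr _+_ 0# (map f xs)

  module _ {a} {X : Set a} where

    sumₗ-cong : {f g : X → Carrier} → (∀ x → f x ≈ g x) → ∀ xs → sumₗ f xs ≈ sumₗ g xs
    sumₗ-cong f≈g []       = refl
    sumₗ-cong f≈g (x ∷ xs) = +-cong (f≈g x) (sumₗ-cong f≈g xs)

    sumₗ-++ : (f : X → Carrier) → ∀ xs ys → sumₗ f (xs ++ ys) ≈ sumₗ f xs + sumₗ f ys
    sumₗ-++ f []       ys = sym (+-identityˡ _)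
    sumₗ-++ f (x ∷ xs) ys = trans (+-congˡ (sumₗ-++ f xs ys)) (sym (+-assoc _ _ _))

    sumₗ-concat-tabulate : (f : X → Carrier) (g : Fin n → List X) →
      sumₗ f (concat (tabulate g)) ≈ sum (λ i → sumₗ f (g i))
    sumₗ-concat-tabulate {n = zero}  f g = refl
    sumₗ-concat-tabulate {n = suc n} f g =
      trans (sumₗ-++ f (g zero) _) (+-congˡ (sumₗ-concat-tabulate f (g ∘ suc)))

    *-distribˡ-sumₗ : ∀ x (f : X → Carrier) ys → x * sumₗ f ys ≈ sumₗ (λ y → x * f y) ys
    *-distribˡ-sumₗ x f []       = zeroʳ x
    *-distribˡ-sumₗ x f (y ∷ ys) = trans (distribˡ x _ _) (+-congˡ (*-distribˡ-sumₗ x f ys))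

  ∑ₚ-cong : {f g : Permutation′ n → Carrier} → (∀ σ → f σ ≈ g σ) → ∑ₚ f ≈ ∑ₚ g
  ∑ₚ-cong {n = n} f≈g = sumₗ-cong f≈g (permutations n)

  -- `permutations (suc n)` is listed in blocks by the image `j` of the first point; this is the
  -- skeleton of expansion along the first row.
  ∑ₚ-suc : (f : Permutation′ (suc n) → Carrier) →
           ∑ₚ f ≈ sum (λ j → ∑ₚ (λ π → f (insert zero j π)))
  ∑ₚ-suc {n = n} f = trans
    (sumₗ-concat-tabulate f (λ j → map (insert zero j) (permutations n)))
    (sum-cong-≋ {suc n} λ j → reflexive (cong (foldr _+_ 0#) (≡.sym (map-∘ {g = f} {insert zero j} (permutations n)))))

  1^n≈1 : ∀ n → 1# ^ n ≈ 1#
  1^n≈1 zero    = refl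
  1^n≈1 (suc n) = trans (*-identityˡ _) (1^n≈1 n)

  -- Minors and Laplace expansion.

  minor : Matrix (suc n) (suc n) → Fin (suc n) → Fin (suc n) → Matrix n n
  minor A i j a b = A (punchIn i a) (punchIn j b)

  -- The permanent for s = 1 and the determinant for s = −1 (see `qper-Leibniz`).
  module _ (s : Carrier) where

    qper : Matrix n n → Carrier
    qper {n = zero}  A = 1#
    qper {n = suc n} A = sum λ j → s ^ toℕ j * A zero j * qper (minor A zero j)

    laplaceTerm : Matrix (suc n) (suc n) → Fin (suc n) → Carrier
    laplaceTerm A j = s ^ toℕ j * A zero j * qper (minor A zero j)

    entry≈0⇒laplaceTerm≈0 : (A : Matrix (suc n) (suc n)) → ∀ j → A zero j ≈ 0# → laplaceTerm A j ≈ 0#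
    entry≈0⇒laplaceTerm≈0 A j A0j≈0 =
      trans (*-congʳ (trans (*-congˡ A0j≈0) (zeroʳ _))) (zeroˡ _)

    minor≈0⇒laplaceTerm≈0 : (A : Matrix (suc n) (suc n)) → ∀ j →
      qper (minor A zero j) ≈ 0# → laplaceTerm A j ≈ 0#
    minor≈0⇒laplaceTerm≈0 A j minor≈0 = trans (*-congˡ minor≈0) (zeroʳ _)

    -- Grouping permutations by the image `j` of the first point turns the Leibniz sum into the
    -- first-row expansion: by `inversions-insert`, that point adds `toℕ j` inversions, hence the
    -- weight `s ^ toℕ j`.
    qper-Leibniz : (A : Matrix n n) →
      ∑ₚ (λ σ → s ^ inversions σ * product (λ i → A i (σ ⟨$⟩ʳ i))) ≈ qper A
    qper-Leibniz {n = zero}  A = trans (+-identityʳ _) (*-identityˡ _)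
    qper-Leibniz {n = suc n} A = trans (∑ₚ-suc {n = n} _) (sum-cong-≋ {suc n} λ j → begin
      ∑ₚ (λ π → s ^ inversions (insert zero j π)
                 * (A zero j * product (λ i → A (suc i) (insert zero j π ⟨$⟩ʳ suc i))))
        ≈⟨ ∑ₚ-cong {n = n} (λ π → term j π) ⟩
      ∑ₚ (λ π → s ^ toℕ j * A zero j
                 * (s ^ inversions π * product (λ i → minor A zero j i (π ⟨$⟩ʳ i))))
        ≈⟨ *-distribˡ-sumₗ _ _ (permutations n) ⟨
      s ^ toℕ j * A zero j
        * ∑ₚ (λ π → s ^ inversions π * product (λ i → minor A zero j i (π ⟨$⟩ʳ i)))
        ≈⟨ *-congˡ (qper-Leibniz (minor A zero j)) ⟩
      s ^ toℕ j * A zero j * qper (minor A zero j) ∎)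
      where
      term : ∀ j (π : Permutation′ n) →
        s ^ inversions (insert zero j π)
          * (A zero j * product (λ i → A (suc i) (insert zero j π ⟨$⟩ʳ suc i)))
        ≈ s ^ toℕ j * A zero j
          * (s ^ inversions π * product (λ i → minor A zero j i (π ⟨$⟩ʳ i)))
      term j π = trans
        (*-cong
          (trans (^-congʳ s (inversions-insert j π)) (^-homo-* s (toℕ j) (inversions π)))
          (*-congˡ (product-cong λ i → reflexive (cong (A (suc i)) (insert-punchIn zero j π i)))))
        (solve 4 (λ t u x y → ((t ⊕ u) ⊕ (x ⊕ y)) ⊜ ((t ⊕ x) ⊕ (u ⊕ y))) refl _ _ _ _)

    qper-cong : {A B : Matrix n n} → (∀ i j → A i j ≈ B i j) → qper A ≈ qper B
    qper-cong {n = zero}  A≈B = refl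
    qper-cong {n = suc n} A≈B = sum-cong-≋ {suc n} λ j →
      *-cong (*-congˡ {s ^ toℕ j} (A≈B zero j)) (qper-cong λ a b → A≈B (suc a) (punchIn j b))

    qper-scale : ∀ x (A : Matrix n n) → qper (λ i j → x * A i j) ≈ x ^ n * qper A
    qper-scale {n = zero}  x A = sym (*-identityˡ 1#)
    qper-scale {n = suc n} x A = trans
      (sum-cong-≋ {suc n} λ j → trans (*-congˡ (qper-scale x (minor A zero j)))
        (solve 5 (λ t x y u z → ((t ⊕ (x ⊕ y)) ⊕ (u ⊕ z)) ⊜ ((x ⊕ u) ⊕ ((t ⊕ y) ⊕ z))) refl (s ^ toℕ j) x (A zero j) _ _))
      (sym (*-distribˡ-sum (x ^ suc n) (laplaceTerm A)))

    -- The corner term is common to both expansions. For the others, each first-row minor is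
    -- expanded along its first column by induction, and the two sums are exchanged.
    qper-expandColumn : (A : Matrix (suc n) (suc n)) →
      qper A ≈ sum (λ i → s ^ toℕ i * A i zero * qper (minor A i zero))
    qper-expandColumn {n = zero}  A = refl
    qper-expandColumn {n = suc n} A = +-congˡ (begin
      sum (λ j → x j * qper (minor A zero (suc j)))
        ≈⟨ sum-cong-≋ {suc n} (λ j → trans
             (*-congˡ {x j} (qper-expandColumn (minor A zero (suc j))))
             (*-distribˡ-sum {suc n} (x j) (λ i → s ^ toℕ i * A (suc i) zero * Q i j))) ⟩
      sum (λ j → sum (λ i → x j * (s ^ toℕ i * A (suc i) zero * Q i j)))
        ≈⟨ ∑-comm (λ j i → x j * (s ^ toℕ i * A (suc i) zero * Q i j)) ⟩
      sum (λ i → sum (λ j → x j * (s ^ toℕ i * A (suc i) zero * Q i j)))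
        ≈⟨ sum-cong-≋ {suc n} (λ i → trans
             -- `s ^ suc (toℕ j)` is `s * s ^ toℕ j`; its loose factor `s` moves from the column
             -- weight to the row weight.
             (sum-cong-≋ {suc n} λ j → solve 6
               (λ s t x u y z → (((s ⊕ t) ⊕ x) ⊕ ((u ⊕ y) ⊕ z)) ⊜ (((s ⊕ u) ⊕ y) ⊕ ((t ⊕ x) ⊕ z)))
               refl s (s ^ toℕ j) (A zero (suc j)) (s ^ toℕ i) (A (suc i) zero) (Q i j))
             (sym (*-distribˡ-sum {suc n} (y i) (λ j → s ^ toℕ j * A zero (suc j) * Q i j)))) ⟩
      sum (λ i → y i * qper (minor A (suc i) zero)) ∎)
      where
      x y : Fin (suc n) → Carrier
      x j = s ^ suc (toℕ j) * A zero (suc j)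
      y i = s ^ suc (toℕ i) * A (suc i) zero
      -- Striking out row `zero` and column `suc j` first, or row `suc i` and column `zero` first,
      -- leads to the same matrix by computation, so one `Q` serves both expansions.
      Q : Fin (suc n) → Fin (suc n) → Carrier
      Q i j = qper (minor (minor A zero (suc j)) i zero)

    -- First-row expansion of the transpose is first-column expansion of `A`, with the transposed
    -- minors handled by induction.
    qper-transpose : (A : Matrix n n) → qper (λ i j → A j i) ≈ qper A
    qper-transpose {n = zero}  A = refl
    qper-transpose {n = suc n} A = trans
      (sum-cong-≋ {suc n} λ j → *-congˡ {s ^ toℕ j * A j zero} (qper-transpose (minor A j zero)))
      (sym (qper-expandColumn A))

    -- Vanishing when rows outnumber their columns.

    -- The `p` left rows are supported on only `p′` left columns, too few to give each row its own.
    -- Expanding the first row keeps this imbalance: a left row can use only a left column, and both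
    -- counts drop; a right row lowers `p′` or neither count.
    qper-pigeonhole : ∀ {p′ q′} (S : Shuffle p q n) (T : Shuffle p′ q′ n) → p′ <ℕ p →
      (A : Matrix n n) → (∀ i j → A (injˡ S i) (injʳ T j) ≈ 0#) → qper A ≈ 0#
    qper-pigeonhole {n = suc n} (left {p = p} S) T p′<p A A≈0 =
      sum-zero (laplaceTerm A) (shuffle-elim T (λ j → laplaceTerm A j ≈ 0#)
        (λ k → minor≈0⇒laplaceTerm≈0 A _ (minor≈0 T p′<p A≈0 k))
        (λ k → entry≈0⇒laplaceTerm≈0 A _ (A≈0 zero k)))
      where
      -- `T` and `p′` are quantified afresh so that `p′` can be matched as a successor, which it is
      -- once a left column `k` exists.
      minor≈0 : ∀ {p′ q′} (T : Shuffle p′ q′ (suc n)) → p′ <ℕ suc p →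
        (∀ i j → A (injˡ (left S) i) (injʳ T j) ≈ 0#) →
        ∀ k → qper (minor A zero (injˡ T k)) ≈ 0#
      minor≈0 {p′ = suc p′} T p′<p A≈0 k = qper-pigeonhole S (removeˡ T k) (s≤s⁻¹ p′<p) _ λ i j →
        trans (reflexive (cong (A _) (injʳ-removeˡ T k j))) (A≈0 (suc i) j)
    qper-pigeonhole {p = p} {n = suc n} (right S) T p′<p A A≈0 =
      sum-zero (laplaceTerm A) (shuffle-elim T (λ j → laplaceTerm A j ≈ 0#)
        (λ k → minor≈0⇒laplaceTerm≈0 A _ (minorˡ≈0 T p′<p A≈0 k))
        (λ k → minor≈0⇒laplaceTerm≈0 A _ (minorʳ≈0 T p′<p A≈0 k)))
      where
      minorˡ≈0 : ∀ {p′ q′} (T : Shuffle p′ q′ (suc n)) → p′ <ℕ p →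
        (∀ i j → A (injˡ (right S) i) (injʳ T j) ≈ 0#) →
        ∀ k → qper (minor A zero (injˡ T k)) ≈ 0#
      -- Here `<⇒≤` yields `suc p′ ≤ p`, which is `p′ < p` by definition.
      minorˡ≈0 {p′ = suc p′} T p′<p A≈0 k = qper-pigeonhole S (removeˡ T k) (ℕ.<⇒≤ p′<p) _ λ i j →
        trans (reflexive (cong (A _) (injʳ-removeˡ T k j))) (A≈0 i j)
      minorʳ≈0 : ∀ {p′ q′} (T : Shuffle p′ q′ (suc n)) → p′ <ℕ p →
        (∀ i j → A (injˡ (right S) i) (injʳ T j) ≈ 0#) →
        ∀ k → qper (minor A zero (injʳ T k)) ≈ 0#
      minorʳ≈0 {q′ = suc q′} T p′<p A≈0 k = qper-pigeonhole S (removeʳ T k) p′<p _ λ i j →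
        trans (reflexive (cong (A _) (injʳ-removeʳ T k j))) (A≈0 i (punchIn k j))

    -- Block factorisation for s² = 1.

    module _ (s*s≈1 : s * s ≈ 1#) where

      s^[d+d]≈1 : ∀ d → s ^ (d +ℕ d) ≈ 1#
      s^[d+d]≈1 d = begin
        s ^ (d +ℕ d)   ≈⟨ ^-homo-* s d d ⟩
        s ^ d * s ^ d  ≈⟨ ^-distrib-* s s d ⟨
        (s * s) ^ d    ≈⟨ ^-congˡ d s*s≈1 ⟩
        1# ^ d         ≈⟨ 1^n≈1 d ⟩
        1#             ∎

      -- n² and n have the same parity: passing from `n` to `suc n` changes them by 2n + 1 and by 1,
      -- both odd.
      s^[n*n]≈s^n : ∀ n → s ^ (n *ℕ n) ≈ s ^ n
      s^[n*n]≈s^n zero    = refl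
      s^[n*n]≈s^n (suc n) = *-congˡ (begin
        s ^ (n +ℕ n *ℕ suc n)          ≈⟨ ^-congʳ s (≡.trans (cong (n +ℕ_) (ℕ.*-suc n n)) (≡.sym (ℕ.+-assoc n n (n *ℕ n)))) ⟩
        s ^ (n +ℕ n +ℕ n *ℕ n)         ≈⟨ ^-homo-* s (n +ℕ n) (n *ℕ n) ⟩
        s ^ (n +ℕ n) * s ^ (n *ℕ n)    ≈⟨ *-cong (s^[d+d]≈1 n) (s^[n*n]≈s^n n) ⟩
        1# * s ^ n                     ≈⟨ *-identityˡ _ ⟩
        s ^ n                          ∎)

      -- Induction on the row shuffle, expanding along the first row. A left row has no contribution
      -- from right columns, so it expands the left block. For a right row, choosing a left column
      -- would leave `p` left rows on `p - 1` left columns, and `qper-pigeonhole` kills that minor;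
      -- so it expands the right block.
      qper-blocks : (S T : Shuffle p q n) (A : Matrix n n) →
        (∀ i j → A (injˡ S i) (injʳ T j) ≈ 0#) →
        qper A ≈ s ^ (crossings S +ℕ crossings T)
                 * (qper (λ i j → A (injˡ S i) (injˡ T j)) * qper (λ i j → A (injʳ S i) (injʳ T j)))
      qper-blocks [] [] A A≈0 = sym (trans (*-identityˡ _) (*-identityˡ _))
      qper-blocks {p = suc p} {q = q} {n = suc n} (left S) T A A≈0 = begin
        qper A
          ≈⟨ sum-shuffle T (laplaceTerm A) ⟩
        sum (laplaceTerm A ∘ injˡ T) + sum (laplaceTerm A ∘ injʳ T)
          ≈⟨ +-cong (sum-cong-≋ {suc p} term)
               (sum-zero _ λ k → entry≈0⇒laplaceTerm≈0 A _ (A≈0 zero k)) ⟩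
        sum (λ k → e * (laplaceTerm Aˡˡ k * qper Aʳʳ)) + 0#
          ≈⟨ +-identityʳ _ ⟩
        sum (λ k → e * (laplaceTerm Aˡˡ k * qper Aʳʳ))
          ≈⟨ *-distribˡ-sum e (λ k → laplaceTerm Aˡˡ k * qper Aʳʳ) ⟨
        e * sum (λ k → laplaceTerm Aˡˡ k * qper Aʳʳ)
          ≈⟨ *-congˡ (*-distribʳ-sum (qper Aʳʳ) (laplaceTerm Aˡˡ)) ⟨
        e * (qper Aˡˡ * qper Aʳʳ) ∎
        where
        e = s ^ (crossings S +ℕ crossings T)
        Aˡˡ : Matrix (suc p) (suc p)
        Aˡˡ i j = A (injˡ (left S) i) (injˡ T j)
        Aʳʳ : Matrix q q
        Aʳʳ i j = A (suc (injʳ S i)) (injʳ T j)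
        exponent : ∀ k → s ^ toℕ (injˡ T k) * s ^ (crossings S +ℕ crossings (removeˡ T k)) ≈ e * s ^ toℕ k
        exponent k = begin
          s ^ toℕ (injˡ T k) * s ^ (crossings S +ℕ crossings (removeˡ T k))
            ≈⟨ *-congˡ (^-homo-* s (crossings S) _) ⟩
          s ^ toℕ (injˡ T k) * (s ^ crossings S * s ^ crossings (removeˡ T k))
            ≈⟨ solve 3 (λ x y z → (x ⊕ (y ⊕ z)) ⊜ (y ⊕ (x ⊕ z))) refl _ _ _ ⟩
          s ^ crossings S * (s ^ toℕ (injˡ T k) * s ^ crossings (removeˡ T k))
            -- The column's place in `A` is traded for its place in the left block; the difference
            -- is the crossings lost from `T`.
            ≈⟨ *-congˡ (trans (sym (^-homo-* s (toℕ (injˡ T k)) _))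
                 (trans (^-congʳ s (crossings-removeˡ T k)) (^-homo-* s (toℕ k) _))) ⟩
          s ^ crossings S * (s ^ toℕ k * s ^ crossings T)
            ≈⟨ solve 3 (λ x y z → (x ⊕ (y ⊕ z)) ⊜ ((x ⊕ z) ⊕ y)) refl _ _ _ ⟩
          s ^ crossings S * s ^ crossings T * s ^ toℕ k
            ≈⟨ *-congʳ (^-homo-* s (crossings S) _) ⟨
          e * s ^ toℕ k ∎
        term : ∀ k → laplaceTerm A (injˡ T k) ≈ e * (laplaceTerm Aˡˡ k * qper Aʳʳ)
        term k = begin
          laplaceTerm A (injˡ T k)
            ≈⟨ *-congˡ (trans
                 (qper-blocks S (removeˡ T k) (minor A zero (injˡ T k)) λ i j →
                   trans (reflexive (cong (A _) (injʳ-removeˡ T k j))) (A≈0 (suc i) j))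
                 (*-congˡ (*-cong
                   (qper-cong λ i j → reflexive (cong (A _) (injˡ-removeˡ T k j)))
                   (qper-cong λ i j → reflexive (cong (A _) (injʳ-removeˡ T k j)))))) ⟩
          s ^ toℕ (injˡ T k) * Aˡˡ zero k
            * (s ^ (crossings S +ℕ crossings (removeˡ T k)) * (qper (minor Aˡˡ zero k) * qper Aʳʳ))
            ≈⟨ solve 5 (λ t x u y z → ((t ⊕ x) ⊕ (u ⊕ (y ⊕ z))) ⊜ ((t ⊕ u) ⊕ (x ⊕ (y ⊕ z)))) refl _ _ _ _ _ ⟩
          s ^ toℕ (injˡ T k) * s ^ (crossings S +ℕ crossings (removeˡ T k))
            * (Aˡˡ zero k * (qper (minor Aˡˡ zero k) * qper Aʳʳ))
            ≈⟨ *-congʳ (exponent k) ⟩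
          e * s ^ toℕ k * (Aˡˡ zero k * (qper (minor Aˡˡ zero k) * qper Aʳʳ))
            ≈⟨ solve 5 (λ t u x y z → ((t ⊕ u) ⊕ (x ⊕ (y ⊕ z))) ⊜ (t ⊕ (((u ⊕ x) ⊕ y) ⊕ z))) refl _ _ _ _ _ ⟩
          e * (laplaceTerm Aˡˡ k * qper Aʳʳ) ∎
      qper-blocks {p = p} {q = suc q} {n = suc n} (right S) T A A≈0 = begin
        qper A
          ≈⟨ sum-shuffle T (laplaceTerm A) ⟩
        sum (laplaceTerm A ∘ injˡ T) + sum (laplaceTerm A ∘ injʳ T)
          ≈⟨ +-cong
               (sum-zero _ λ k → minor≈0⇒laplaceTerm≈0 A _ (minor≈0 S T A≈0 k))
               (sum-cong-≋ {suc q} term) ⟩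
        0# + sum (λ k → e * (qper Aˡˡ * laplaceTerm Aʳʳ k))
          ≈⟨ +-identityˡ _ ⟩
        sum (λ k → e * (qper Aˡˡ * laplaceTerm Aʳʳ k))
          ≈⟨ *-distribˡ-sum e (λ k → qper Aˡˡ * laplaceTerm Aʳʳ k) ⟨
        e * sum (λ k → qper Aˡˡ * laplaceTerm Aʳʳ k)
          ≈⟨ *-congˡ (*-distribˡ-sum (qper Aˡˡ) (laplaceTerm Aʳʳ)) ⟨
        e * (qper Aˡˡ * qper Aʳʳ) ∎
        where
        -- By definition `crossings (right S)` is `p +ℕ crossings S`: a right first row precedes all
        -- `p` left rows.
        e = s ^ (p +ℕ crossings S +ℕ crossings T)
        Aˡˡ : Matrix p p
        Aˡˡ i j = A (suc (injˡ S i)) (injˡ T j)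
        Aʳʳ : Matrix (suc q) (suc q)
        Aʳʳ i j = A (injʳ (right S) i) (injʳ T j)
        minor≈0 : ∀ {p q q′} (S : Shuffle p q n) (T : Shuffle p q′ (suc n)) →
          (∀ i j → A (suc (injˡ S i)) (injʳ T j) ≈ 0#) →
          ∀ k → qper (minor A zero (injˡ T k)) ≈ 0#
        minor≈0 {p = suc p} S T A≈0 k = qper-pigeonhole S (removeˡ T k) ℕ.≤-refl _ λ i j →
          trans (reflexive (cong (A _) (injʳ-removeˡ T k j))) (A≈0 i j)
        exponent : ∀ k → s ^ toℕ (injʳ T k) * s ^ (crossings S +ℕ crossings (removeʳ T k)) ≈ e * s ^ toℕ k
        exponent k with d , eq ← crossings-removeʳ T k = begin
          s ^ toℕ (injʳ T k) * s ^ (crossings S +ℕ crossings (removeʳ T k))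
            ≈⟨ *-congˡ (^-homo-* s (crossings S) _) ⟩
          s ^ toℕ (injʳ T k) * (s ^ crossings S * s ^ crossings (removeʳ T k))
            ≈⟨ solve 3 (λ x y z → (x ⊕ (y ⊕ z)) ⊜ (y ⊕ (x ⊕ z))) refl _ _ _ ⟩
          s ^ crossings S * (s ^ toℕ (injʳ T k) * s ^ crossings (removeʳ T k))
            -- Here s² = 1 enters: the inserted even power supplies the `d +ℕ d` of
            -- `crossings-removeʳ`, and the `p` which that equation returns is the one in `e`.
            ≈⟨ *-congˡ (trans (*-congʳ (s^[d+d]≈1 d)) (*-identityˡ _)) ⟨
          s ^ crossings S * (s ^ (d +ℕ d) * (s ^ toℕ (injʳ T k) * s ^ crossings (removeʳ T k)))
            ≈⟨ *-congˡ (trans (^-homo-* s (d +ℕ d) _) (*-congˡ (^-homo-* s (toℕ (injʳ T k)) _))) ⟨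
          s ^ crossings S * s ^ (d +ℕ d +ℕ (toℕ (injʳ T k) +ℕ crossings (removeʳ T k)))
            ≈⟨ *-congˡ (trans (^-congʳ s (≡.sym eq))
                 (trans (^-homo-* s (toℕ k) _) (*-congˡ (^-homo-* s p _)))) ⟩
          s ^ crossings S * (s ^ toℕ k * (s ^ p * s ^ crossings T))
            ≈⟨ solve 4 (λ x y z w → (x ⊕ (y ⊕ (z ⊕ w))) ⊜ (((z ⊕ x) ⊕ w) ⊕ y)) refl _ _ _ _ ⟩
          s ^ p * s ^ crossings S * s ^ crossings T * s ^ toℕ k
            ≈⟨ *-congʳ (trans (^-homo-* s (p +ℕ crossings S) _) (*-congʳ (^-homo-* s p _))) ⟨
          e * s ^ toℕ k ∎
        term : ∀ k → laplaceTerm A (injʳ T k) ≈ e * (qper Aˡˡ * laplaceTerm Aʳʳ k)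
        term k = begin
          laplaceTerm A (injʳ T k)
            ≈⟨ *-congˡ (trans
                 (qper-blocks S (removeʳ T k) (minor A zero (injʳ T k)) λ i j →
                   trans (reflexive (cong (A _) (injʳ-removeʳ T k j))) (A≈0 i (punchIn k j)))
                 (*-congˡ (*-cong
                   (qper-cong λ i j → reflexive (cong (A _) (injˡ-removeʳ T k j)))
                   (qper-cong λ i j → reflexive (cong (A _) (injʳ-removeʳ T k j)))))) ⟩
          s ^ toℕ (injʳ T k) * Aʳʳ zero k
            * (s ^ (crossings S +ℕ crossings (removeʳ T k)) * (qper Aˡˡ * qper (minor Aʳʳ zero k)))
            ≈⟨ solve 5 (λ t x u y z → ((t ⊕ x) ⊕ (u ⊕ (y ⊕ z))) ⊜ ((t ⊕ u) ⊕ (x ⊕ (y ⊕ z)))) refl _ _ _ _ _ ⟩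
          s ^ toℕ (injʳ T k) * s ^ (crossings S +ℕ crossings (removeʳ T k))
            * (Aʳʳ zero k * (qper Aˡˡ * qper (minor Aʳʳ zero k)))
            ≈⟨ *-congʳ (exponent k) ⟩
          e * s ^ toℕ k * (Aʳʳ zero k * (qper Aˡˡ * qper (minor Aʳʳ zero k)))
            ≈⟨ solve 5 (λ t u x y z → ((t ⊕ u) ⊕ (x ⊕ (y ⊕ z))) ⊜ (t ⊕ (y ⊕ ((u ⊕ x) ⊕ z)))) refl _ _ _ _ _ ⟩
          e * (qper Aˡˡ * laplaceTerm Aʳʳ k) ∎

      -- The diagonal blocks of a skew-symmetric matrix.

      qper-skewSymmetric : ∀ m (A : Matrix (m *ℕ 2) (m *ℕ 2)) → SkewSymmetric A →
        (∀ (i j : Fin m) → A (2× i) (2× j) ≈ 0#) →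
        qper A ≈ s ^ m * (- 1#) ^ m * qper (λ (i j : Fin m) → A (2× i) (2×-1 j)) ^ 2
      qper-skewSymmetric m A A-skew A≈0 = begin
        qper A
          ≈⟨ qper-blocks (evens m) (odds m) A (λ i j →
               trans (reflexive (cong₂ A (injˡ-evens {m} i) (injʳ-odds {m} j))) (A≈0 i j)) ⟩
        s ^ (crossings (evens m) +ℕ crossings (odds m))
          * (qper (λ i j → A (injˡ (evens m) i) (injˡ (odds m) j))
             * qper (λ i j → A (injʳ (evens m) i) (injʳ (odds m) j)))
          ≈⟨ *-cong (trans (^-congʳ s (crossings-evens-odds m)) (s^[n*n]≈s^n m)) (*-cong
               (qper-cong λ i j → reflexive (cong₂ A (injˡ-evens {m} i) (injˡ-odds {m} j)))
               -- Skew symmetry turns the block of odd rows and even columns into `-Cᵀ`; the sign is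
               -- written as the scalar `- 1#` so that `qper-scale` can extract it.
               (qper-cong λ i j → trans (reflexive (cong₂ A (injʳ-evens {m} i) (injʳ-odds {m} j)))
                 (trans (A-skew (2× j) (2×-1 i)) (sym (-1*x≈-x _))))) ⟩
        s ^ m * (qper C * qper (λ i j → - 1# * C j i))
          ≈⟨ *-congˡ (*-congˡ (trans (qper-scale (- 1#) (λ i j → C j i)) (*-congˡ (qper-transpose C)))) ⟩
        s ^ m * (qper C * ((- 1#) ^ m * qper C))
          ≈⟨ solve 3 (λ t u x → (t ⊕ (x ⊕ (u ⊕ x))) ⊜ ((t ⊕ u) ⊕ (x ⊕ x))) refl _ _ _ ⟩
        s ^ m * (- 1#) ^ m * (qper C * qper C)
          -- `x ^ 2` unfolds to `x * (x * 1#)`.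
          ≈⟨ *-congˡ (*-congˡ (*-identityʳ _)) ⟨
        s ^ m * (- 1#) ^ m * qper C ^ 2 ∎
        where
        C : Matrix m m
        C i j = A (2× i) (2×-1 j)

  -- Specialisation to the permanent and the determinant.

  per≈qper : (A : Matrix n n) → per A ≈ qper 1# A
  per≈qper {n = n} A = trans
    (∑ₚ-cong {n = n} λ σ → sym (trans (*-congʳ (1^n≈1 (inversions σ))) (*-identityˡ _)))
    (qper-Leibniz 1# A)

  -1*-1≈1 : - 1# * - 1# ≈ 1#
  -1*-1≈1 = trans (-1*x≈-x (- 1#)) (-‿involutive 1#)

corollary1p4 : ∀ {c ℓ} (R : CommutativeRing c ℓ) →
    let open CommutativeRing R
        open Matrices R
    in
    (m : ℕ) → .{{_ : NonZero m}} →
    (A : Matrix (m *ℕ 2) (m *ℕ 2)) →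
    SkewSymmetric A →
    (∀ i j q → 2 ≤ q → index i +ℕ index j ≡ 2 *ℕ q → A i j ≈ 0#) →
    (per A ≈ (- 1#) ^ m * (per (λ (i j : Fin m) → A (2× i) (2×-1 j))) ^ 2)
    × (det A ≈ (det (λ (i j : Fin m) → A (2× i) (2×-1 j))) ^ 2)
corollary1p4 R m A A-skew A≈0 = permanent , determinant
  where
  open CommutativeRing R
  open Matrices R
  open Exponentiation commutativeSemiring using (^-congˡ)
  open SetoidReasoning setoid

  C : Matrix m m
  C i j = A (2× i) (2×-1 j)

  even-block≈0 : ∀ (i j : Fin m) → A (2× i) (2× j) ≈ 0#
  -- 2i + 2j = 2q with q = i + j in 1-based indices, and q ≥ 2 because each index is at least 1.
  even-block≈0 i j = A≈0 (2× i) (2× j) (index i +ℕ index j)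
    (ℕ.+-mono-≤ {1} {index i} {1} {index j} (s≤s z≤n) (s≤s z≤n))
    (≡.trans (cong₂ _+ℕ_ (index-2× i) (index-2× j))
             (≡.sym (ℕ.*-distribˡ-+ 2 (index i) (index j))))

  permanent : per A ≈ (- 1#) ^ m * per C ^ 2
  permanent = begin
    per A                                   ≈⟨ per≈qper R A ⟩
    qper R 1# A                             ≈⟨ qper-skewSymmetric R 1# (*-identityˡ 1#) m A A-skew even-block≈0 ⟩
    1# ^ m * (- 1#) ^ m * qper R 1# C ^ 2   ≈⟨ *-cong (trans (*-congʳ (1^n≈1 R m)) (*-identityˡ _)) (^-congˡ 2 (sym (per≈qper R C))) ⟩
    (- 1#) ^ m * per C ^ 2                  ∎

  determinant : det A ≈ det C ^ 2
  determinant = begin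
    det A                                            ≈⟨ qper-Leibniz R (- 1#) A ⟩
    qper R (- 1#) A                                  ≈⟨ qper-skewSymmetric R (- 1#) (-1*-1≈1 R) m A A-skew even-block≈0 ⟩
    (- 1#) ^ m * (- 1#) ^ m * qper R (- 1#) C ^ 2    ≈⟨ *-cong
      -- The sign `s ^ m` from the interleavings cancels the sign from skew symmetry, as (-1)^(m+m)
      -- = 1.
      (trans (sym (^-homo-* (- 1#) m m)) (s^[d+d]≈1 R (- 1#) (-1*-1≈1 R) m))
      (^-congˡ 2 (sym (qper-Leibniz R (- 1#) C))) ⟩
    1# * det C ^ 2                                   ≈⟨ *-identityˡ _ ⟩
    det C ^ 2                                        ∎
    where open Exponentiation commutativeSemiring using (^-homo-*)
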